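{- Let $\mathcal A$ be cocomplete, $\lambda:MH\to HM$ a distributive law of the pointed endofunctor $(M,\eta)$ over $H$ with $\lambda$-interpretation $b:MC\to C$, and let $k=c^{ -1}\cdot Hb$ and $k'=b\cdot Mk:MHMC\to C$. Then $(C,k')$ is a completely iterative algebra for $MHM$.
   Context: $\mathcal A$ has binary products and coproducts; $H:\mathcal A\to\mathcal A$ is a functor with terminal coalgebra $c:C\to HC$ (an isomorphism by Lambek's lemma). A pointed endofunctor is a functor $M$ with a natural transformation $\eta:\mathrm{Id}\to M$. A distributive law of $(M,\eta)$ over $H$ is a natural transformation $\lambda:MH\to HM$ with $\lambda\cdot\eta H=H\eta$. Its $\lambda$-interpretation is the unique morphism $b:MC\to C$ with $c\cdot b=Hb\cdot\lambda_C\cdot Mc$; it satisfies $b\cdot\eta_C=\mathrm{id}_C$. A $G$-algebra $a:GA\to A$ is a completely iterative algebra if every $e:X\to GX+A$ has a unique $e^\dagger:X\to A$ with $e^\dagger=[a,\mathrm{id}_A]\cdot(Ge^\dagger+\mathrm{id}_A)\cdot e$. -}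

module Defs where

open import Level using (Level; _⊔_; suc)
open import Data.Product using (proj₁; proj₂; ∃!)
open import Relation.Binary.Bundles using (Setoid)
open import Relation.Binary.Core using (Rel)
open import Relation.Binary.Structures using (IsEquivalence)
import Relation.Binary.Reasoning.Setoid as SetoidReasoning

-- Hom-sets are setoids; equality of morphisms is _≈_.
record Category (o ℓ e : Level) : Set (suc (o ⊔ ℓ ⊔ e)) where
  infix  4 _⇒_ _≈_
  infixr 9 _∘_
  field
    Obj       : Set o
    _⇒_       : Obj → Obj → Set ℓ
    _≈_       : {A B : Obj} → Rel (A ⇒ B) e
    id        : {A : Obj} → A ⇒ A
    _∘_       : {A B C : Obj} → B ⇒ C → A ⇒ B → A ⇒ C
    equiv     : {A B : Obj} → IsEquivalence (_≈_ {A} {B})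
    assoc     : {A B C D : Obj} {f : A ⇒ B} {g : B ⇒ C} {h : C ⇒ D} →
                (h ∘ g) ∘ f ≈ h ∘ (g ∘ f)
    identityˡ : {A B : Obj} {f : A ⇒ B} → id ∘ f ≈ f
    identityʳ : {A B : Obj} {f : A ⇒ B} → f ∘ id ≈ f
    ∘-resp-≈  : {A B C : Obj} {f h : B ⇒ C} {g i : A ⇒ B} →
                f ≈ h → g ≈ i → f ∘ g ≈ h ∘ i

  module Equiv {A B : Obj} = IsEquivalence (equiv {A} {B})

  homSetoid : Obj → Obj → Setoid ℓ e
  homSetoid A B = record { Carrier = A ⇒ B ; _≈_ = _≈_ ; isEquivalence = equiv }

  module HomReasoning {A B : Obj} = SetoidReasoning (homSetoid A B)

  record Iso {A B : Obj} (f : A ⇒ B) : Set (ℓ ⊔ e) where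
    field
      inv  : B ⇒ A
      isoˡ : inv ∘ f ≈ id
      isoʳ : f ∘ inv ≈ id

record Functor {o ℓ e o′ ℓ′ e′ : Level}
               (C : Category o ℓ e) (D : Category o′ ℓ′ e′) :
               Set (o ⊔ ℓ ⊔ e ⊔ o′ ⊔ ℓ′ ⊔ e′) where
  private
    module C = Category C
    module D = Category D
  field
    F₀           : C.Obj → D.Obj
    F₁           : {A B : C.Obj} → A C.⇒ B → F₀ A D.⇒ F₀ B
    identity     : {A : C.Obj} → F₁ (C.id {A}) D.≈ D.id
    homomorphism : {X Y Z : C.Obj} {f : X C.⇒ Y} {g : Y C.⇒ Z} →
                   F₁ (g C.∘ f) D.≈ F₁ g D.∘ F₁ f
    F-resp-≈     : {A B : C.Obj} {f g : A C.⇒ B} → f C.≈ g → F₁ f D.≈ F₁ g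

Endofunctor : {o ℓ e : Level} → Category o ℓ e → Set (o ⊔ ℓ ⊔ e)
Endofunctor C = Functor C C

idF : {o ℓ e : Level} {C : Category o ℓ e} → Endofunctor C
idF {C = C} = record
  { F₀           = λ A → A
  ; F₁           = λ f → f
  ; identity     = Equiv.refl
  ; homomorphism = Equiv.refl
  ; F-resp-≈     = λ p → p
  } where open Category C

infixr 9 _∘F_

_∘F_ : {o ℓ e o′ ℓ′ e′ o″ ℓ″ e″ : Level}
       {C : Category o ℓ e} {D : Category o′ ℓ′ e′} {E : Category o″ ℓ″ e″} →
       Functor D E → Functor C D → Functor C E
_∘F_ {E = E} G F = record
  { F₀           = λ A → G.F₀ (F.F₀ A)
  ; F₁           = λ f → G.F₁ (F.F₁ f)
  ; identity     = Equiv.trans (G.F-resp-≈ F.identity) G.identity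
  ; homomorphism = Equiv.trans (G.F-resp-≈ F.homomorphism) G.homomorphism
  ; F-resp-≈     = λ p → G.F-resp-≈ (F.F-resp-≈ p)
  }
  where
  open Category E
  module G = Functor G
  module F = Functor F

record NaturalTransformation {o ℓ e o′ ℓ′ e′ : Level}
                             {C : Category o ℓ e} {D : Category o′ ℓ′ e′}
                             (F G : Functor C D) :
                             Set (o ⊔ ℓ ⊔ e ⊔ o′ ⊔ ℓ′ ⊔ e′) where
  private
    module C = Category C
    module D = Category D
    module F = Functor F
    module G = Functor G
  field
    component : (X : C.Obj) → F.F₀ X D.⇒ G.F₀ X
    natural   : {X Y : C.Obj} (f : X C.⇒ Y) →
                component Y D.∘ F.F₁ f D.≈ G.F₁ f D.∘ component X

module _ {o ℓ e o′ ℓ′ e′ : Level}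
         {J : Category o′ ℓ′ e′} {C : Category o ℓ e} (F : Functor J C) where
  private
    module J = Category J
    module F = Functor F
  open Category C

  record Cocone : Set (o ⊔ ℓ ⊔ e ⊔ o′ ⊔ ℓ′) where
    field
      apex    : Obj
      leg     : (j : J.Obj) → F.F₀ j ⇒ apex
      commute : {i j : J.Obj} (f : i J.⇒ j) → leg j ∘ F.F₁ f ≈ leg i

  record Colimit : Set (o ⊔ ℓ ⊔ e ⊔ o′ ⊔ ℓ′) where
    field
      cocone : Cocone
    open Cocone cocone public
    field
      universal : (K : Cocone) →
                  ∃! _≈_ λ (h : apex ⇒ Cocone.apex K) →
                    (j : J.Obj) → h ∘ leg j ≈ Cocone.leg K j

-- The levels o′ ℓ′ e′ specify which diagram shapes count as small.
Cocomplete : {o ℓ e : Level} (o′ ℓ′ e′ : Level) → Category o ℓ e →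
             Set (o ⊔ ℓ ⊔ e ⊔ suc (o′ ⊔ ℓ′ ⊔ e′))
Cocomplete o′ ℓ′ e′ C = (J : Category o′ ℓ′ e′) (F : Functor J C) → Colimit F

module _ {o ℓ e : Level} (𝒜 : Category o ℓ e) where
  open Category 𝒜

  record BinaryProducts : Set (o ⊔ ℓ ⊔ e) where
    infixr 7 _⊗_
    field
      _⊗_      : Obj → Obj → Obj
      π₁       : {A B : Obj} → A ⊗ B ⇒ A
      π₂       : {A B : Obj} → A ⊗ B ⇒ B
      ⟨_,_⟩    : {A B X : Obj} → X ⇒ A → X ⇒ B → X ⇒ A ⊗ B
      project₁ : {A B X : Obj} {f : X ⇒ A} {g : X ⇒ B} → π₁ ∘ ⟨ f , g ⟩ ≈ f
      project₂ : {A B X : Obj} {f : X ⇒ A} {g : X ⇒ B} → π₂ ∘ ⟨ f , g ⟩ ≈ g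
      unique   : {A B X : Obj} {f : X ⇒ A} {g : X ⇒ B} {h : X ⇒ A ⊗ B} →
                 π₁ ∘ h ≈ f → π₂ ∘ h ≈ g → ⟨ f , g ⟩ ≈ h

  record BinaryCoproducts : Set (o ⊔ ℓ ⊔ e) where
    infixr 6 _+_ _+₁_
    field
      _+_     : Obj → Obj → Obj
      i₁      : {A B : Obj} → A ⇒ A + B
      i₂      : {A B : Obj} → B ⇒ A + B
      [_,_]   : {A B X : Obj} → A ⇒ X → B ⇒ X → A + B ⇒ X
      inject₁ : {A B X : Obj} {f : A ⇒ X} {g : B ⇒ X} → [ f , g ] ∘ i₁ ≈ f
      inject₂ : {A B X : Obj} {f : A ⇒ X} {g : B ⇒ X} → [ f , g ] ∘ i₂ ≈ g
      unique  : {A B X : Obj} {f : A ⇒ X} {g : B ⇒ X} {h : A + B ⇒ X} →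
                h ∘ i₁ ≈ f → h ∘ i₂ ≈ g → [ f , g ] ≈ h

    _+₁_ : {A B C D : Obj} → A ⇒ C → B ⇒ D → A + B ⇒ C + D
    f +₁ g = [ i₁ ∘ f , i₂ ∘ g ]

module _ {o ℓ e : Level} {𝒜 : Category o ℓ e} where
  open Category 𝒜

  IsCompletelyIterative : BinaryCoproducts 𝒜 → (G : Endofunctor 𝒜) {A : Obj} →
                          Functor.F₀ G A ⇒ A → Set (o ⊔ ℓ ⊔ e)
  IsCompletelyIterative coproducts G {A} a =
    (X : Obj) (eq : X ⇒ G₀ X + A) →
    ∃! _≈_ λ (eq† : X ⇒ A) → eq† ≈ [ a , id ] ∘ (G₁ eq† +₁ id) ∘ eq
    where
    open BinaryCoproducts coproducts
    open Functor G renaming (F₀ to G₀; F₁ to G₁)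

  record TerminalCoalgebra (H : Endofunctor 𝒜) : Set (o ⊔ ℓ ⊔ e) where
    open Functor H renaming (F₀ to H₀; F₁ to H₁)
    field
      C        : Obj
      c        : C ⇒ H₀ C
      terminal : {X : Obj} (x : X ⇒ H₀ X) →
                 ∃! _≈_ λ (h : X ⇒ C) → c ∘ h ≈ H₁ h ∘ x

    unfold : {X : Obj} → X ⇒ H₀ X → X ⇒ C
    unfold x = proj₁ (terminal x)

    unfold-commute : {X : Obj} (x : X ⇒ H₀ X) → c ∘ unfold x ≈ H₁ (unfold x) ∘ x
    unfold-commute x = proj₁ (proj₂ (terminal x))

    unfold-unique : {X : Obj} (x : X ⇒ H₀ X) {h : X ⇒ C} →
                    c ∘ h ≈ H₁ h ∘ x → unfold x ≈ h
    unfold-unique x = proj₂ (proj₂ (terminal x))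

    lambek : Iso c
    lambek = record { inv = i ; isoˡ = i∘c≈id ; isoʳ = c∘i≈id }
      where
      open HomReasoning
      i : H₀ C ⇒ C
      i = unfold (H₁ c)

      i∘c≈id : i ∘ c ≈ id
      i∘c≈id = Equiv.trans (Equiv.sym (unfold-unique c hom)) (unfold-unique c hom-id)
        where
        hom : c ∘ (i ∘ c) ≈ H₁ (i ∘ c) ∘ c
        hom = begin
          c ∘ (i ∘ c)        ≈⟨ assoc ⟨
          (c ∘ i) ∘ c        ≈⟨ ∘-resp-≈ (unfold-commute (H₁ c)) Equiv.refl ⟩
          (H₁ i ∘ H₁ c) ∘ c  ≈⟨ ∘-resp-≈ homomorphism Equiv.refl ⟨
          H₁ (i ∘ c) ∘ c     ∎

        hom-id : c ∘ id ≈ H₁ id ∘ c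
        hom-id = begin
          c ∘ id     ≈⟨ identityʳ ⟩
          c          ≈⟨ identityˡ ⟨
          id ∘ c     ≈⟨ ∘-resp-≈ identity Equiv.refl ⟨
          H₁ id ∘ c  ∎

      c∘i≈id : c ∘ i ≈ id
      c∘i≈id = begin
        c ∘ i        ≈⟨ unfold-commute (H₁ c) ⟩
        H₁ i ∘ H₁ c  ≈⟨ homomorphism ⟨
        H₁ (i ∘ c)   ≈⟨ F-resp-≈ i∘c≈id ⟩
        H₁ id        ≈⟨ identity ⟩
        id           ∎

    c⁻¹ : H₀ C ⇒ C
    c⁻¹ = Iso.inv lambek

record PointedEndofunctor {o ℓ e : Level} (𝒜 : Category o ℓ e) : Set (o ⊔ ℓ ⊔ e) where
  field
    M : Endofunctor 𝒜
    η : NaturalTransformation idF M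

record DistributiveLaw {o ℓ e : Level} {𝒜 : Category o ℓ e}
                       (P : PointedEndofunctor 𝒜) (H : Endofunctor 𝒜) :
                       Set (o ⊔ ℓ ⊔ e) where
  open Category 𝒜
  open PointedEndofunctor P
  open NaturalTransformation η renaming (component to η-at) using ()
  open Functor H renaming (F₀ to H₀; F₁ to H₁) using ()
  field
    law : NaturalTransformation (M ∘F H) (H ∘F M)
  open NaturalTransformation law public
  field
    unit : (X : Obj) → component X ∘ η-at (H₀ X) ≈ H₁ (η-at X)

module Interpretation {o ℓ e : Level} {𝒜 : Category o ℓ e}
                      {P : PointedEndofunctor 𝒜} {H : Endofunctor 𝒜}
                      (T : TerminalCoalgebra H) (Λ : DistributiveLaw P H) where
  open Category 𝒜
  open PointedEndofunctor P using (M)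
  open Functor M renaming (F₀ to M₀; F₁ to M₁) using ()
  open Functor H renaming (F₀ to H₀; F₁ to H₁) using ()
  open TerminalCoalgebra T
  open DistributiveLaw Λ using () renaming (component to λ-at)

  b : M₀ C ⇒ C
  b = unfold (λ-at C ∘ M₁ c)

  b-commute : c ∘ b ≈ H₁ b ∘ λ-at C ∘ M₁ c
  b-commute = unfold-commute (λ-at C ∘ M₁ c)

  b-unique : {h : M₀ C ⇒ C} → c ∘ h ≈ H₁ h ∘ λ-at C ∘ M₁ c → b ≈ h
  b-unique = unfold-unique (λ-at C ∘ M₁ c)

  k : H₀ (M₀ C) ⇒ C
  k = c⁻¹ ∘ H₁ b

  k′ : M₀ (H₀ (M₀ C)) ⇒ C
  k′ = b ∘ M₁ k

{-# OPTIONS --safe #-}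

-- For a functor N with a law ν : NH → HN and an N-algebra b on C compatible
-- with ν, every w : W → HNW has a unique u with c · u = H(b · Nu) · w: the
-- morphisms NⁿW → HNⁿ⁺¹W obtained from w and ν form an H-coalgebra on the
-- countable coproduct of the NⁿW, and finality forces its unfolding to be of the
-- form u, b · Nu, b · N(b · Nu), ….  This is applied to N = MM with b · Mb.
-- A solution s of e : X → MHMX + C is b · M[t, id] · p for t = k · HMs and
-- p = [M i₁, η · i₂] · e, and [t, id] : HMX + C → C is exactly the u above for a
-- suitable w : HMX + C → HMM(HMX + C).
module Submission where

open import Level using (Level; Lift; lift; lower)
open import Data.Nat using (ℕ; zero; suc)
open import Data.Product using (_,_; proj₁; proj₂; ∃!)
open import Relation.Binary.PropositionalEquality as ≡ using (_≡_)
open import Relation.Binary.PropositionalEquality.Properties as ≡ₚ using ()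
open import Defs

-- The discrete category on the natural numbers

discreteℕ : (o ℓ e : Level) → Category o ℓ e
discreteℕ o ℓ e = record
  -- The lifts put this shape at arbitrary levels, so that it counts as small whichever levels
  -- `Cocomplete` is taken at.
  { Obj       = Lift o ℕ
  ; _⇒_       = λ m n → Lift ℓ (lower m ≡ lower n)
  ; _≈_       = λ p q → Lift e (lower p ≡ lower q)
  ; id        = lift ≡.refl
  ; _∘_       = λ q p → lift (≡.trans (lower p) (lower q))
  ; equiv     = record
    { refl  = lift ≡.refl
    ; sym   = λ p → lift (≡.sym (lower p))
    ; trans = λ p q → lift (≡.trans (lower p) (lower q))
    }
  ; assoc     = λ {_} {_} {_} {_} {f} → lift (≡.sym (≡ₚ.trans-assoc (lower f)))
  ; identityˡ = λ {_} {_} {f} → lift (≡ₚ.trans-reflʳ (lower f))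
  ; identityʳ = lift ≡.refl
  ; ∘-resp-≈  = λ p q → lift (≡.cong₂ ≡.trans (lower q) (lower p))
  }

-- Rewriting with composites

module CategoryProperties {o ℓ e : Level} (𝒜 : Category o ℓ e) where
  open Category 𝒜

  ∘-congˡ : ∀ {A B D} {f : B ⇒ D} {g h : A ⇒ B} → g ≈ h → f ∘ g ≈ f ∘ h
  ∘-congˡ p = ∘-resp-≈ Equiv.refl p

  ∘-congʳ : ∀ {A B D} {f g : B ⇒ D} {h : A ⇒ B} → f ≈ g → f ∘ h ≈ g ∘ h
  ∘-congʳ p = ∘-resp-≈ p Equiv.refl

  pullˡ : ∀ {A B D E} {h : D ⇒ E} {g : B ⇒ D} {k : B ⇒ E} {f : A ⇒ B} →
          h ∘ g ≈ k → h ∘ (g ∘ f) ≈ k ∘ f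
  pullˡ p = Equiv.trans (Equiv.sym assoc) (∘-congʳ p)

  pullʳ : ∀ {A B D E} {h : D ⇒ E} {g : B ⇒ D} {f : A ⇒ B} {k : A ⇒ D} →
          g ∘ f ≈ k → (h ∘ g) ∘ f ≈ h ∘ k
  pullʳ p = Equiv.trans assoc (∘-congˡ p)

-- Countable coproducts as colimits of discrete diagrams

module CountableCoproducts {o ℓ e o′ ℓ′ e′ : Level} {𝒜 : Category o ℓ e}
                           (cocomplete : Cocomplete o′ ℓ′ e′ 𝒜)
                           (Y : ℕ → Category.Obj 𝒜) where
  open Category 𝒜

  family : Functor (discreteℕ o′ ℓ′ e′) 𝒜
  family = record
    { F₀           = λ n → Y (lower n)
    ; F₁           = λ { (lift ≡.refl) → id }
    ; identity     = Equiv.refl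
    ; homomorphism = λ { {f = lift ≡.refl} {g = lift ≡.refl} → Equiv.sym identityˡ }
    ; F-resp-≈     = λ { {f = lift ≡.refl} {g = lift _} (lift ≡.refl) → Equiv.refl }
    }

  cocone : {A : Obj} → (∀ n → Y n ⇒ A) → Cocone family
  cocone {A} f = record
    { apex    = A
    ; leg     = λ n → f (lower n)
    ; commute = λ { (lift ≡.refl) → identityʳ }
    }

  private module Colim = Colimit (cocomplete (discreteℕ o′ ℓ′ e′) family)

  ∐ : Obj
  ∐ = Colim.apex

  inj : ∀ n → Y n ⇒ ∐
  inj n = Colim.leg (lift n)

  copair : {A : Obj} → (∀ n → Y n ⇒ A) → ∐ ⇒ A
  copair f = proj₁ (Colim.universal (cocone f))

  copair-inj : {A : Obj} (f : ∀ n → Y n ⇒ A) → ∀ n → copair f ∘ inj n ≈ f n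
  copair-inj f n = proj₁ (proj₂ (Colim.universal (cocone f))) (lift n)

  copair-unique : {A : Obj} (f : ∀ n → Y n ⇒ A) {h : ∐ ⇒ A} →
                  (∀ n → h ∘ inj n ≈ f n) → copair f ≈ h
  copair-unique f p = proj₂ (proj₂ (Colim.universal (cocone f))) (λ n → p (lower n))

  inj-jointly-epic : {A : Obj} {g h : ∐ ⇒ A} →
                     (∀ n → g ∘ inj n ≈ h ∘ inj n) → g ≈ h
  inj-jointly-epic {h = h} p =
    Equiv.trans (Equiv.sym (copair-unique _ p)) (copair-unique _ λ _ → Equiv.refl)

-- Binary coproducts

module CoproductProperties {o ℓ e : Level} {𝒜 : Category o ℓ e}
                           (coproducts : BinaryCoproducts 𝒜) where
  open Category 𝒜
  open CategoryProperties 𝒜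
  open BinaryCoproducts coproducts

  +-ext : ∀ {A B D} {f g : A + B ⇒ D} → f ∘ i₁ ≈ g ∘ i₁ → f ∘ i₂ ≈ g ∘ i₂ → f ≈ g
  +-ext p q = Equiv.trans (Equiv.sym (unique p q)) (unique Equiv.refl Equiv.refl)

  []-congʳ : ∀ {A B D} {f f′ : A ⇒ D} {g : B ⇒ D} → f ≈ f′ → [ f , g ] ≈ [ f′ , g ]
  []-congʳ p = unique (Equiv.trans inject₁ (Equiv.sym p)) inject₂

  ∘-distribˡ-[] : ∀ {A B D E} {f : A ⇒ D} {g : B ⇒ D} {h : D ⇒ E} →
                  h ∘ [ f , g ] ≈ [ h ∘ f , h ∘ g ]
  ∘-distribˡ-[] = Equiv.sym (unique (pullʳ inject₁) (pullʳ inject₂))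

  []∘+₁id : ∀ {A B D E} {f : A ⇒ B} {g : B ⇒ D} {h : E ⇒ D} →
            [ g , h ] ∘ (f +₁ id) ≈ [ g ∘ f , h ]
  []∘+₁id = Equiv.sym (unique
    (Equiv.trans (pullʳ inject₁) (pullˡ inject₁))
    (Equiv.trans (pullʳ inject₂) (Equiv.trans (pullˡ inject₂) identityʳ)))

-- Systems of maps `Y n ⇒ H₀ (Y (suc n))` and their unique solutions

module SequenceCoiteration {o ℓ e o′ ℓ′ e′ : Level} {𝒜 : Category o ℓ e}
                           (cocomplete : Cocomplete o′ ℓ′ e′ 𝒜)
                           {H : Endofunctor 𝒜} (T : TerminalCoalgebra H)
                           (Y : ℕ → Category.Obj 𝒜)
                           (d : ∀ n → Category._⇒_ 𝒜 (Y n) (Functor.F₀ H (Y (suc n)))) where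
  open Category 𝒜
  open CategoryProperties 𝒜
  open HomReasoning
  open Functor H renaming (F₀ to H₀; F₁ to H₁)
  open TerminalCoalgebra T
  open CountableCoproducts cocomplete Y

  IsSolution : (∀ n → Y n ⇒ C) → Set e
  IsSolution h = ∀ n → c ∘ h n ≈ H₁ (h (suc n)) ∘ d n

  -- Summand `n` is sent into summand `suc n`, so coalgebra homomorphisms from here to `c` are
  -- exactly the families satisfying `IsSolution`.
  coalgebra : ∐ ⇒ H₀ ∐
  coalgebra = copair λ n → H₁ (inj (suc n)) ∘ d n

  solution : ∀ n → Y n ⇒ C
  solution n = unfold coalgebra ∘ inj n

  solution-isSolution : IsSolution solution
  solution-isSolution n = begin
    c ∘ unfold coalgebra ∘ inj n                   ≈⟨ pullˡ (unfold-commute coalgebra) ⟩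
    (H₁ (unfold coalgebra) ∘ coalgebra) ∘ inj n    ≈⟨ pullʳ (copair-inj _ n) ⟩
    H₁ (unfold coalgebra) ∘ H₁ (inj (suc n)) ∘ d n ≈⟨ pullˡ (Equiv.sym homomorphism) ⟩
    H₁ (solution (suc n)) ∘ d n                    ∎

  -- The copairing of any solution is a coalgebra homomorphism, checked summand by summand, so
  -- finality makes it equal to the unfolding.
  solution-unique : {h : ∀ n → Y n ⇒ C} → IsSolution h → ∀ n → solution n ≈ h n
  solution-unique {h} h-sol n = begin
    unfold coalgebra ∘ inj n ≈⟨ ∘-congʳ (unfold-unique coalgebra (inj-jointly-epic hom)) ⟩
    copair h ∘ inj n         ≈⟨ copair-inj h n ⟩
    h n                      ∎
    where
    hom : ∀ m → (c ∘ copair h) ∘ inj m ≈ (H₁ (copair h) ∘ coalgebra) ∘ inj m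
    hom m = begin
      (c ∘ copair h) ∘ inj m                  ≈⟨ pullʳ (copair-inj h m) ⟩
      c ∘ h m                                 ≈⟨ h-sol m ⟩
      H₁ (h (suc m)) ∘ d m                    ≈⟨ ∘-congʳ (F-resp-≈ (copair-inj h (suc m))) ⟨
      H₁ (copair h ∘ inj (suc m)) ∘ d m       ≈⟨ pullˡ (Equiv.sym homomorphism) ⟨
      H₁ (copair h) ∘ H₁ (inj (suc m)) ∘ d m  ≈⟨ pullʳ (copair-inj _ m) ⟨
      (H₁ (copair h) ∘ coalgebra) ∘ inj m     ∎

-- Coiteration through a functor with a law over `H`

module Coiteration {o ℓ e o′ ℓ′ e′ : Level} {𝒜 : Category o ℓ e}
                   (cocomplete : Cocomplete o′ ℓ′ e′ 𝒜)
                   {H : Endofunctor 𝒜} (T : TerminalCoalgebra H)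
                   (N : Endofunctor 𝒜) (ν : NaturalTransformation (N ∘F H) (H ∘F N)) where
  open Category 𝒜
  open CategoryProperties 𝒜
  open HomReasoning
  open Functor H renaming (F₀ to H₀; F₁ to H₁; homomorphism to H-∘; F-resp-≈ to H-cong) using ()
  open Functor N renaming (F₀ to N₀; F₁ to N₁; homomorphism to N-∘; F-resp-≈ to N-cong) using ()
  open NaturalTransformation ν renaming (component to ν-at)
  open TerminalCoalgebra T

  module _ (b : N₀ C ⇒ C) (b-commute : c ∘ b ≈ H₁ b ∘ ν-at C ∘ N₁ c) where

    -- Naturality of `ν` carries one step of a system through `N`. This is the inductive step for
    -- every sequence of the form `x`, `b ∘ N₁ x`, and so on.
    b∘N-commute : ∀ {A B} {x : A ⇒ C} {y : B ⇒ C} {d : A ⇒ H₀ B} →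
                  c ∘ x ≈ H₁ y ∘ d →
                  c ∘ b ∘ N₁ x ≈ H₁ (b ∘ N₁ y) ∘ ν-at B ∘ N₁ d
    b∘N-commute {B = B} {x} {y} {d} p = begin
      c ∘ b ∘ N₁ x                       ≈⟨ pullˡ b-commute ⟩
      (H₁ b ∘ ν-at C ∘ N₁ c) ∘ N₁ x      ≈⟨ pullʳ assoc ⟩
      H₁ b ∘ ν-at C ∘ N₁ c ∘ N₁ x        ≈⟨ ∘-congˡ (∘-congˡ N-∘) ⟨
      H₁ b ∘ ν-at C ∘ N₁ (c ∘ x)         ≈⟨ ∘-congˡ (∘-congˡ (N-cong p)) ⟩
      H₁ b ∘ ν-at C ∘ N₁ (H₁ y ∘ d)      ≈⟨ ∘-congˡ (∘-congˡ N-∘) ⟩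
      H₁ b ∘ ν-at C ∘ N₁ (H₁ y) ∘ N₁ d   ≈⟨ ∘-congˡ (pullˡ (natural y)) ⟩
      H₁ b ∘ (H₁ (N₁ y) ∘ ν-at B) ∘ N₁ d ≈⟨ ∘-congˡ assoc ⟩
      H₁ b ∘ H₁ (N₁ y) ∘ ν-at B ∘ N₁ d   ≈⟨ pullˡ (Equiv.sym H-∘) ⟩
      H₁ (b ∘ N₁ y) ∘ ν-at B ∘ N₁ d      ∎

    coiteration : {W : Obj} (w : W ⇒ H₀ (N₀ W)) →
                  ∃! _≈_ λ (u : W ⇒ C) → c ∘ u ≈ H₁ (b ∘ N₁ u) ∘ w
    coiteration {W} w = S.solution 0 , u-commute , u-unique
      where
      Nⁿ : ℕ → Obj
      Nⁿ zero    = W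
      Nⁿ (suc n) = N₀ (Nⁿ n)

      d : ∀ n → Nⁿ n ⇒ H₀ (Nⁿ (suc n))
      d zero    = w
      d (suc n) = ν-at (Nⁿ (suc n)) ∘ N₁ (d n)

      module S = SequenceCoiteration cocomplete T Nⁿ d
      -- The same system with index 0 dropped; it involves only the steps built from `ν`, not `w`
      -- directly.
      module S⁺ = SequenceCoiteration cocomplete T (λ n → Nⁿ (suc n)) (λ n → d (suc n))

      -- The shift of `S.solution` and its image under `b ∘ N₁` both solve the shifted system, so
      -- they agree, in particular at its first index.
      solution₁ : S.solution 1 ≈ b ∘ N₁ (S.solution 0)
      solution₁ = Equiv.trans
        (Equiv.sym (S⁺.solution-unique (λ n → S.solution-isSolution (suc n)) 0))
        (S⁺.solution-unique {λ n → b ∘ N₁ (S.solution n)}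
          (λ n → b∘N-commute (S.solution-isSolution n)) 0)

      u-commute : c ∘ S.solution 0 ≈ H₁ (b ∘ N₁ (S.solution 0)) ∘ w
      u-commute = Equiv.trans (S.solution-isSolution 0) (∘-congʳ (H-cong solution₁))

      u-unique : {v : W ⇒ C} → c ∘ v ≈ H₁ (b ∘ N₁ v) ∘ w → S.solution 0 ≈ v
      u-unique {v} p = S.solution-unique {vⁿ} vⁿ-isSolution 0
        where
        -- A single `v` determines a whole candidate sequence; the hypothesis on `v` is its equation
        -- at index 0.
        vⁿ : ∀ n → Nⁿ n ⇒ C
        vⁿ zero    = v
        vⁿ (suc n) = b ∘ N₁ (vⁿ n)

        vⁿ-isSolution : S.IsSolution vⁿ
        vⁿ-isSolution zero    = p
        vⁿ-isSolution (suc n) = b∘N-commute (vⁿ-isSolution n)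

-- Distributive laws and the algebra `k′`

module Sandwich {o ℓ e o′ ℓ′ e′ : Level} {𝒜 : Category o ℓ e}
                (coproducts : BinaryCoproducts 𝒜)
                (cocomplete : Cocomplete o′ ℓ′ e′ 𝒜)
                {H : Endofunctor 𝒜} (T : TerminalCoalgebra H)
                {P : PointedEndofunctor 𝒜} (Λ : DistributiveLaw P H) where
  open Category 𝒜
  open CategoryProperties 𝒜
  open HomReasoning
  open BinaryCoproducts coproducts
  open CoproductProperties coproducts
  open PointedEndofunctor P
  open Functor H renaming (F₀ to H₀; F₁ to H₁; identity to H-id; homomorphism to H-∘; F-resp-≈ to H-cong) using ()
  open Functor M renaming (F₀ to M₀; F₁ to M₁; homomorphism to M-∘; F-resp-≈ to M-cong) using ()
  open NaturalTransformation η renaming (component to η-at; natural to η-natural)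
  open DistributiveLaw Λ renaming (component to λ-at; natural to λ-natural)
  open TerminalCoalgebra T
  open Interpretation T Λ

  private
    module L = Iso lambek

  -- Both `h` and `id` are homomorphisms from the terminal coalgebra to itself.
  endo≈id : {h : C ⇒ C} → c ∘ h ≈ H₁ h ∘ c → h ≈ id
  endo≈id p = Equiv.trans (Equiv.sym (unfold-unique c p))
    (unfold-unique c (Equiv.trans identityʳ
      (Equiv.sym (Equiv.trans (∘-congʳ H-id) identityˡ))))

  -- Naturality of `η` and the unit law of `Λ` make `b ∘ η-at C` an endomorphism of the terminal
  -- coalgebra.
  b∘η≈id : b ∘ η-at C ≈ id
  b∘η≈id = endo≈id (begin
    c ∘ b ∘ η-at C                      ≈⟨ pullˡ b-commute ⟩
    (H₁ b ∘ λ-at C ∘ M₁ c) ∘ η-at C     ≈⟨ pullʳ (pullʳ (Equiv.sym (η-natural c))) ⟩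
    H₁ b ∘ λ-at C ∘ η-at (H₀ C) ∘ c     ≈⟨ ∘-congˡ (pullˡ (unit C)) ⟩
    H₁ b ∘ H₁ (η-at C) ∘ c              ≈⟨ pullˡ (Equiv.sym H-∘) ⟩
    H₁ (b ∘ η-at C) ∘ c                 ∎)

  b∘M∘η : {A : Obj} (u : A ⇒ C) → (b ∘ M₁ u) ∘ η-at A ≈ u
  b∘M∘η {A} u = begin
    (b ∘ M₁ u) ∘ η-at A ≈⟨ pullʳ (Equiv.sym (η-natural u)) ⟩
    b ∘ η-at C ∘ u      ≈⟨ pullˡ b∘η≈id ⟩
    id ∘ u              ≈⟨ identityˡ ⟩
    u                   ∎

  -- Two layers of `M` are needed because `t (s u)` applies `M` twice to `u`: once in `s`, once
  -- under `H` in `t`.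
  λ² : NaturalTransformation ((M ∘F M) ∘F H) (H ∘F (M ∘F M))
  λ² = record
    { component = λ A → λ-at (M₀ A) ∘ M₁ (λ-at A)
    ; natural   = λ {A} {B} f → begin
        (λ-at (M₀ B) ∘ M₁ (λ-at B)) ∘ M₁ (M₁ (H₁ f)) ≈⟨ pullʳ (Equiv.sym M-∘) ⟩
        λ-at (M₀ B) ∘ M₁ (λ-at B ∘ M₁ (H₁ f))        ≈⟨ ∘-congˡ (M-cong (λ-natural f)) ⟩
        λ-at (M₀ B) ∘ M₁ (H₁ (M₁ f) ∘ λ-at A)        ≈⟨ ∘-congˡ M-∘ ⟩
        λ-at (M₀ B) ∘ M₁ (H₁ (M₁ f)) ∘ M₁ (λ-at A)   ≈⟨ pullˡ (λ-natural (M₁ f)) ⟩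
        (H₁ (M₁ (M₁ f)) ∘ λ-at (M₀ A)) ∘ M₁ (λ-at A) ≈⟨ assoc ⟩
        H₁ (M₁ (M₁ f)) ∘ λ-at (M₀ A) ∘ M₁ (λ-at A)   ∎
    }

  b² : M₀ (M₀ C) ⇒ C
  b² = b ∘ M₁ b

  -- This is `b∘N-commute` for `N = M`, fed with the defining square of `b` itself.
  b²-commute : c ∘ b² ≈ H₁ b² ∘ (λ-at (M₀ C) ∘ M₁ (λ-at C)) ∘ M₁ (M₁ c)
  b²-commute = begin
    c ∘ b²                                             ≈⟨ Coiteration.b∘N-commute cocomplete T M law b b-commute b-commute ⟩
    H₁ b² ∘ λ-at (M₀ C) ∘ M₁ (λ-at C ∘ M₁ c)           ≈⟨ ∘-congˡ (pullʳ (Equiv.sym M-∘)) ⟨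
    H₁ b² ∘ (λ-at (M₀ C) ∘ M₁ (λ-at C)) ∘ M₁ (M₁ c)    ∎

  b²∘MM : {A : Obj} (u : A ⇒ C) → b² ∘ M₁ (M₁ u) ≈ b ∘ M₁ (b ∘ M₁ u)
  b²∘MM u = pullʳ (Equiv.sym M-∘)

  η² : (A : Obj) → A ⇒ M₀ (M₀ A)
  η² A = M₁ (η-at A) ∘ η-at A

  -- The units cancel one at a time, first the one under `M`, then the outer one.
  b²∘MM∘η² : {A : Obj} (u : A ⇒ C) → (b² ∘ M₁ (M₁ u)) ∘ η² A ≈ u
  b²∘MM∘η² {A} u = begin
    (b² ∘ M₁ (M₁ u)) ∘ η² A                        ≈⟨ ∘-congʳ (b²∘MM u) ⟩
    (b ∘ M₁ (b ∘ M₁ u)) ∘ M₁ (η-at A) ∘ η-at A     ≈⟨ pullˡ (pullʳ (Equiv.sym M-∘)) ⟩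
    (b ∘ M₁ ((b ∘ M₁ u) ∘ η-at A)) ∘ η-at A        ≈⟨ ∘-congʳ (∘-congˡ (M-cong (b∘M∘η u))) ⟩
    (b ∘ M₁ u) ∘ η-at A                            ≈⟨ b∘M∘η u ⟩
    u                                              ∎

  -- Solving one equation morphism

  module _ {X : Obj} (eq : X ⇒ M₀ (H₀ (M₀ X)) + C) where

    W : Obj
    W = H₀ (M₀ X) + C

    -- Constants from `C` enter `M₀ W` through `η`, so both summands of the codomain of `eq` lie
    -- under one `M`.
    p : X ⇒ M₀ W
    p = [ M₁ i₁ , η-at W ∘ i₂ ] ∘ eq

    -- The left branch makes one step of the equation under `HM`. The right branch replays `c`,
    -- padded with two units that `b²` later cancels.
    w : W ⇒ H₀ (M₀ (M₀ W))
    w = [ H₁ (M₁ p) , H₁ (η² W ∘ i₂) ∘ c ]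

    -- Solutions of `eq` are the `f` with `f ≈ s (t f)`, coiterates of `w` the `u` with
    -- `u ≈ t (s u)`; `t` and `s` translate between the two.
    t : (X ⇒ C) → (W ⇒ C)
    t s = [ k ∘ H₁ (M₁ s) , id ]

    s : (W ⇒ C) → (X ⇒ C)
    s u = b ∘ M₁ u ∘ p

    t-cong : {f g : X ⇒ C} → f ≈ g → t f ≈ t g
    t-cong q = []-congʳ (∘-congˡ (H-cong (M-cong q)))

    s-cong : {u v : W ⇒ C} → u ≈ v → s u ≈ s v
    s-cong q = ∘-congˡ (∘-congʳ (M-cong q))

    -- On the left summand this unfolds `k′` as `b ∘ M₁ k`; on the right `b` cancels the unit in
    -- `p`.
    rhs≈s∘t : (f : X ⇒ C) → [ k′ , id ] ∘ (M₁ (H₁ (M₁ f)) +₁ id) ∘ eq ≈ s (t f)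
    rhs≈s∘t f = begin
      [ k′ , id ] ∘ (M₁ (H₁ (M₁ f)) +₁ id) ∘ eq                  ≈⟨ pullˡ []∘+₁id ⟩
      [ k′ ∘ M₁ (H₁ (M₁ f)) , id ] ∘ eq                          ≈⟨ ∘-congʳ (unique left right) ⟩
      ((b ∘ M₁ (t f)) ∘ [ M₁ i₁ , η-at W ∘ i₂ ]) ∘ eq            ≈⟨ assoc ⟩
      (b ∘ M₁ (t f)) ∘ p                                         ≈⟨ assoc ⟩
      s (t f)                                                    ∎
      where
      left : ((b ∘ M₁ (t f)) ∘ [ M₁ i₁ , η-at W ∘ i₂ ]) ∘ i₁ ≈ k′ ∘ M₁ (H₁ (M₁ f))
      left = begin
        ((b ∘ M₁ (t f)) ∘ [ M₁ i₁ , η-at W ∘ i₂ ]) ∘ i₁ ≈⟨ pullʳ inject₁ ⟩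
        (b ∘ M₁ (t f)) ∘ M₁ i₁                          ≈⟨ pullʳ (Equiv.sym M-∘) ⟩
        b ∘ M₁ (t f ∘ i₁)                               ≈⟨ ∘-congˡ (M-cong inject₁) ⟩
        b ∘ M₁ (k ∘ H₁ (M₁ f))                          ≈⟨ pullʳ (Equiv.sym M-∘) ⟨
        k′ ∘ M₁ (H₁ (M₁ f))                             ∎

      right : ((b ∘ M₁ (t f)) ∘ [ M₁ i₁ , η-at W ∘ i₂ ]) ∘ i₂ ≈ id
      right = begin
        ((b ∘ M₁ (t f)) ∘ [ M₁ i₁ , η-at W ∘ i₂ ]) ∘ i₂ ≈⟨ pullʳ inject₂ ⟩
        (b ∘ M₁ (t f)) ∘ η-at W ∘ i₂                    ≈⟨ pullˡ (b∘M∘η (t f)) ⟩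
        t f ∘ i₂                                        ≈⟨ inject₂ ⟩
        id                                              ∎

    H[b²∘MM]∘w∘i₁ : (u : W ⇒ C) → (H₁ (b² ∘ M₁ (M₁ u)) ∘ w) ∘ i₁ ≈ H₁ b ∘ H₁ (M₁ (s u))
    H[b²∘MM]∘w∘i₁ u = begin
      (H₁ (b² ∘ M₁ (M₁ u)) ∘ w) ∘ i₁         ≈⟨ pullʳ inject₁ ⟩
      H₁ (b² ∘ M₁ (M₁ u)) ∘ H₁ (M₁ p)        ≈⟨ H-∘ ⟨
      H₁ ((b² ∘ M₁ (M₁ u)) ∘ M₁ p)           ≈⟨ H-cong (∘-congʳ (b²∘MM u)) ⟩
      H₁ ((b ∘ M₁ (b ∘ M₁ u)) ∘ M₁ p)        ≈⟨ H-cong (pullʳ (Equiv.sym M-∘)) ⟩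
      H₁ (b ∘ M₁ ((b ∘ M₁ u) ∘ p))           ≈⟨ H-cong (∘-congˡ (M-cong assoc)) ⟩
      H₁ (b ∘ M₁ (s u))                      ≈⟨ H-∘ ⟩
      H₁ b ∘ H₁ (M₁ (s u))                   ∎

    H[b²∘MM]∘w∘i₂ : (u : W ⇒ C) → (H₁ (b² ∘ M₁ (M₁ u)) ∘ w) ∘ i₂ ≈ H₁ (u ∘ i₂) ∘ c
    H[b²∘MM]∘w∘i₂ u = begin
      (H₁ (b² ∘ M₁ (M₁ u)) ∘ w) ∘ i₂                 ≈⟨ pullʳ inject₂ ⟩
      H₁ (b² ∘ M₁ (M₁ u)) ∘ H₁ (η² W ∘ i₂) ∘ c       ≈⟨ pullˡ (Equiv.sym H-∘) ⟩
      H₁ ((b² ∘ M₁ (M₁ u)) ∘ η² W ∘ i₂) ∘ c          ≈⟨ ∘-congʳ (H-cong (pullˡ (b²∘MM∘η² u))) ⟩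
      H₁ (u ∘ i₂) ∘ c                                ∎

    -- On the left summand `c` is invertible, which turns the coiteration equation into one with
    -- `k`.
    coiterate⇒fixed : {u : W ⇒ C} → c ∘ u ≈ H₁ (b² ∘ M₁ (M₁ u)) ∘ w → u ≈ t (s u)
    coiterate⇒fixed {u} q = Equiv.sym (unique left right)
      where
      left : u ∘ i₁ ≈ k ∘ H₁ (M₁ (s u))
      left = begin
        u ∘ i₁                                   ≈⟨ identityˡ ⟨
        id ∘ u ∘ i₁                              ≈⟨ pullˡ L.isoˡ ⟨
        c⁻¹ ∘ c ∘ u ∘ i₁                         ≈⟨ ∘-congˡ (pullˡ q) ⟩
        c⁻¹ ∘ (H₁ (b² ∘ M₁ (M₁ u)) ∘ w) ∘ i₁     ≈⟨ ∘-congˡ (H[b²∘MM]∘w∘i₁ u) ⟩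
        c⁻¹ ∘ H₁ b ∘ H₁ (M₁ (s u))               ≈⟨ assoc ⟨
        k ∘ H₁ (M₁ (s u))                        ∎

      -- On constants the equation says that `u ∘ i₂` is an endomorphism of the terminal coalgebra.
      right : u ∘ i₂ ≈ id
      right = endo≈id (Equiv.trans (pullˡ q) (H[b²∘MM]∘w∘i₂ u))

    fixed⇒coiterate : {u : W ⇒ C} → u ≈ t (s u) → c ∘ u ≈ H₁ (b² ∘ M₁ (M₁ u)) ∘ w
    fixed⇒coiterate {u} q = +-ext left right
      where
      left : (c ∘ u) ∘ i₁ ≈ (H₁ (b² ∘ M₁ (M₁ u)) ∘ w) ∘ i₁
      left = begin
        (c ∘ u) ∘ i₁                         ≈⟨ pullʳ (Equiv.trans (∘-congʳ q) inject₁) ⟩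
        c ∘ (c⁻¹ ∘ H₁ b) ∘ H₁ (M₁ (s u))     ≈⟨ ∘-congˡ assoc ⟩
        c ∘ c⁻¹ ∘ H₁ b ∘ H₁ (M₁ (s u))       ≈⟨ pullˡ L.isoʳ ⟩
        id ∘ H₁ b ∘ H₁ (M₁ (s u))            ≈⟨ identityˡ ⟩
        H₁ b ∘ H₁ (M₁ (s u))                 ≈⟨ H[b²∘MM]∘w∘i₁ u ⟨
        (H₁ (b² ∘ M₁ (M₁ u)) ∘ w) ∘ i₁       ∎

      u∘i₂≈id : u ∘ i₂ ≈ id
      u∘i₂≈id = Equiv.trans (∘-congʳ q) inject₂

      right : (c ∘ u) ∘ i₂ ≈ (H₁ (b² ∘ M₁ (M₁ u)) ∘ w) ∘ i₂
      right = begin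
        (c ∘ u) ∘ i₂                     ≈⟨ pullʳ u∘i₂≈id ⟩
        c ∘ id                           ≈⟨ identityʳ ⟩
        c                                ≈⟨ identityˡ ⟨
        id ∘ c                           ≈⟨ ∘-congʳ H-id ⟨
        H₁ id ∘ c                        ≈⟨ ∘-congʳ (H-cong u∘i₂≈id) ⟨
        H₁ (u ∘ i₂) ∘ c                  ≈⟨ H[b²∘MM]∘w∘i₂ u ⟨
        (H₁ (b² ∘ M₁ (M₁ u)) ∘ w) ∘ i₂   ∎

    coiterate : ∃! _≈_ λ (u : W ⇒ C) → c ∘ u ≈ H₁ (b² ∘ M₁ (M₁ u)) ∘ w
    coiterate = Coiteration.coiteration cocomplete T (M ∘F M) λ² b² b²-commute w

    eq† : X ⇒ C
    eq† = s (proj₁ coiterate)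

    eq†-isSolution : eq† ≈ [ k′ , id ] ∘ (M₁ (H₁ (M₁ eq†)) +₁ id) ∘ eq
    eq†-isSolution = Equiv.trans
      (s-cong (coiterate⇒fixed (proj₁ (proj₂ coiterate))))
      (Equiv.sym (rhs≈s∘t eq†))

    eq†-unique : {y : X ⇒ C} →
                 y ≈ [ k′ , id ] ∘ (M₁ (H₁ (M₁ y)) +₁ id) ∘ eq → eq† ≈ y
    eq†-unique {y} y-sol = Equiv.trans
      -- Applying `t` to `y ≈ s (t y)` shows that `t y` is a fixed point, hence the coiterate; `s`
      -- then returns `y`.
      (s-cong (proj₂ (proj₂ coiterate) (fixed⇒coiterate (t-cong y≈s[ty]))))
      (Equiv.sym y≈s[ty])
      where
      y≈s[ty] : y ≈ s (t y)
      y≈s[ty] = Equiv.trans y-sol (rhs≈s∘t y)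

  k′-completelyIterative : IsCompletelyIterative coproducts (M ∘F H ∘F M) k′
  k′-completelyIterative X eq = eq† eq , eq†-isSolution eq , eq†-unique eq

mainTheorem20 :
    {o ℓ e o′ ℓ′ e′ : Level}
    (𝒜 : Category o ℓ e)
    (products : BinaryProducts 𝒜)
    (coproducts : BinaryCoproducts 𝒜)
    (cocomplete : Cocomplete o′ ℓ′ e′ 𝒜)
    (H : Endofunctor 𝒜)
    (T : TerminalCoalgebra H)
    (P : PointedEndofunctor 𝒜)
    (Λ : DistributiveLaw P H) →
    let open PointedEndofunctor P using (M)
        open Interpretation T Λ using (k′)
    in IsCompletelyIterative coproducts (M ∘F H ∘F M) k′
mainTheorem20 𝒜 products coproducts cocomplete H T P Λ =
  Sandwich.k′-completelyIterative coproducts cocomplete T Λ
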